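{- There exists a family of binary strings $(w_k)_{k \ge 1}$ over the alphabet $\{a,b\}$ such that the ratio $z_e(w_k)/z_{end}(w_k)$ asymptotically approaches $2$ as $k \to \infty$.
   Context: For a string $w$, a parsing of $w$ is a sequence of non-empty strings $q_1,\ldots,q_z$ with $w = q_1\cdots q_z$ (the phrases). The (greedy) LZ-End parsing of $w$ is the parsing $q_1,\ldots,q_{z_e}$ determined from left to right by: $q_i$ is a single symbol if that position is the leftmost occurrence of the symbol in $w$; otherwise $q_i$ is the longest prefix of $q_i \cdots q_{z_e}$ (the remaining suffix of $w$) that occurs as a suffix of $q_1 \cdots q_j$ for some $j < i$. Its number of phrases is denoted $z_e(w)$. An LZ-End-like parsing of $w$ is a parsing $q_1,\ldots,q_z$ such that each $q_i$ is either a single symbol at its leftmost occurrence in $w$, or a (not necessarily longest) suffix of $q_1\cdots q_j$ for some $j<i$. The minimum number of phrases over all LZ-End-like parsings of $w$ is denoted $z_{end}(w)$ (the size of an optimal LZ-End parsing). -}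

module Defs where

open import Data.Nat using (ℕ; _≤_; _<_; _*_; ∣_-_∣)
open import Data.Bool using (Bool)
open import Data.List using (List; []; _∷_; _++_; concat; take; length)
open import Data.List.Membership.Propositional using (_∈_; _∉_)
open import Data.List.Relation.Unary.All using (All)
open import Data.Product using (Σ; ∃; _×_; _,_)
open import Data.Sum using (_⊎_)
open import Relation.Binary.PropositionalEquality using (_≡_; _≢_)

-- Binary alphabet {a,b}: a = false, b = true.
Str : Set
Str = List Bool

Suffix : Str → Str → Set
Suffix s t = ∃ λ u → u ++ s ≡ t

Prefix : Str → Str → Set
Prefix p t = ∃ λ u → p ++ u ≡ t

IsParsing : Str → List Str → Set
IsParsing w qs = All (λ q → q ≢ []) qs × concat qs ≡ w

EndSuffix : List Str → Str → Set
EndSuffix pre s = ∃ λ j → 1 ≤ j × j ≤ length pre × Suffix s (concat (take j pre))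

ValidPhrase : List Str → Str → Set
ValidPhrase pre q = (∃ λ c → q ≡ c ∷ [] × c ∉ concat pre) ⊎ EndSuffix pre q

IsLZEndLike : Str → List Str → Set
IsLZEndLike w qs = IsParsing w qs ×
  (∀ pre q post → qs ≡ pre ++ q ∷ post → ValidPhrase pre q)

-- Greedy step: pre = q_1 … q_{i-1}, q = q_i, R = q_i ⋯ q_z (remaining suffix).
GreedyStep : List Str → Str → Str → Set
GreedyStep pre q R =
  (∃ λ c → ∃ λ rest → R ≡ c ∷ rest × c ∉ concat pre × q ≡ c ∷ [])
  ⊎ (∃ λ c → ∃ λ rest → R ≡ c ∷ rest × c ∈ concat pre × EndSuffix pre q ×
       (∀ p → Prefix p R → EndSuffix pre p → length p ≤ length q))

IsLZEnd : Str → List Str → Set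
IsLZEnd w qs = IsParsing w qs ×
  (∀ pre q post → qs ≡ pre ++ q ∷ post → GreedyStep pre q (concat (q ∷ post)))

ZE : Str → ℕ → Set
ZE w n = ∃ λ qs → IsLZEnd w qs × length qs ≡ n

ZEnd : Str → ℕ → Set
ZEnd w n = (∃ λ qs → IsLZEndLike w qs × length qs ≡ n)
         × (∀ qs → IsLZEndLike w qs → n ≤ length qs)

-- The sequence of ratios x k / y k tends to 2:
-- for every ε = 1/n > 0, eventually |x k / y k − 2| < ε,
-- written multiplied out as n · |x k − 2 y k| < y k (which also forces y k > 0).
RatioTendsTo2 : (ℕ → ℕ) → (ℕ → ℕ) → Set
RatioTendsTo2 x y = ∀ n → 1 ≤ n → ∃ λ K → ∀ k → K ≤ k →
  n * ∣ x k - 2 * y k ∣ < y k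

{-# OPTIONS --safe #-}
module Submission where

-- A word is described by its runs: r₁, r₂, … stands for a^r₁ b a^r₂ b ⋯.  Take
--   m, m, 0, m, 1, 0, 2, 0, …, n, 0   with m = 2^k and n = m − 1,
-- that is, a^m b a^m b b a^m b followed by the units a^j bb for j = 1, …, n.
-- Ending a phrase right after a^m bb makes every unit a suffix of it, hence a single phrase.
-- The greedy parsing instead takes b a^m b across that point, so it has no earlier phrase end
-- after a^j bb when it reaches unit j, and splits the unit as a^j b | b.
-- Thus greedy uses k + 4 + 2n phrases and the optimum at most k + 5 + n; the optimum is at
-- least n because each factor b a^j b is new at its first occurrence.

open import Defs
open import Data.Bool using (Bool; true; false)
import Data.Bool.Properties as Bool
open import Data.Empty using (⊥; ⊥-elim)
open import Data.List
  using (List; []; _∷_; [_]; _∷ʳ_; _++_; concat; take; drop; length; replicate; filter;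
         concatMap; initLast; _∷ʳ′_)
open import Data.List.Extrema using (argmin; argmin-all; f[argmin]≤v⁺)
open import Data.List.Membership.DecPropositional Bool._≟_ using (_∈?_)
open import Data.List.Membership.Propositional using (_∈_; _∉_; lose)
open import Data.List.Membership.Propositional.Properties
  using (∈-++⁺ˡ; ∈-++⁺ʳ; ∈-concatMap⁺; ∈-filter⁺)
open import Data.List.Properties
open import Data.List.Relation.Unary.All as All using (All; []; _∷_; all?)
open import Data.List.Relation.Unary.All.Properties using (all-filter; ∷ʳ⁺)
open import Data.List.Relation.Unary.Any using (here; there)
open import Data.List.Reverse using (Reverse; []; _∶_∶ʳ_; reverseView)
open import Data.Nat
  using (ℕ; zero; suc; pred; _+_; _*_; _^_; _∸_; _≤_; _<_; z≤n; s≤s; s≤s⁻¹; _≤?_; ∣_-_∣; >-nonZero)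
open import Data.Nat.Properties
open import Data.Nat.Tactic.RingSolver using (solve-∀)
open import Data.Product using (∃; _×_; _,_; proj₁; proj₂)
open import Data.Sum using (_⊎_; inj₁; inj₂; [_,_]′)
open import Function using (_∘_; case_of_)
open import Relation.Binary.PropositionalEquality hiding ([_])
open import Relation.Nullary using (¬_; Dec; yes; no; contradiction)
open import Relation.Nullary.Decidable using (map′; _×-dec_; _⊎-dec_; ¬?)

-- Existence of an optimal parsing

suffix? : ∀ s t → Dec (Suffix s t)
suffix? s t with ≡-dec Bool._≟_ s t
suffix? s t       | yes s≡t = yes ([] , s≡t)
suffix? s []      | no  s≢t = no λ
  { ([] , eq) → s≢t eq }
suffix? s (c ∷ t) | no  s≢t = map′
  (λ { (u , eq) → c ∷ u , cong (c ∷_) eq })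
  (λ { ([] , eq) → contradiction eq s≢t ; (_ ∷ u , refl) → u , refl })
  (suffix? s t)

endSuffix? : ∀ pre s → Dec (EndSuffix pre s)
endSuffix? pre s = map′
  (λ { (j , s≤s j≤ , 1≤j , suf) → j , 1≤j , j≤ , suf })
  (λ { (j , 1≤j , j≤ , suf) → j , s≤s j≤ , 1≤j , suf })
  (anyUpTo? (λ j → (1 ≤? j) ×-dec suffix? s (concat (take j pre))) (suc (length pre)))

newSymbol? : ∀ (pre : List Str) (q : Str) → Dec (∃ λ c → q ≡ c ∷ [] × c ∉ concat pre)
newSymbol? pre []          = no λ ()
newSymbol? pre (c ∷ [])    = map′ (λ c∉ → c , refl , c∉) (λ { (_ , refl , c∉) → c∉ })
                                  (¬? (c ∈? concat pre))
newSymbol? pre (_ ∷ _ ∷ _) = no λ ()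

validPhrase? : ∀ pre q → Dec (ValidPhrase pre q)
validPhrase? pre q = newSymbol? pre q ⊎-dec endSuffix? pre q

-- `P` is general because the recursion moves the head phrase into its first argument.
everyPhrase? : ∀ {P : List Str → Str → Set} → (∀ pre q → Dec (P pre q)) → ∀ qs →
  Dec (∀ pre q post → qs ≡ pre ++ q ∷ post → P pre q)
everyPhrase? P? [] = yes λ { [] _ _ () ; (_ ∷ _) _ _ () }
everyPhrase? P? (q ∷ qs) = map′
  (λ { (p , ps) → λ { [] _ _ refl → p ; (_ ∷ pre) _ _ refl → ps pre _ _ refl } })
  (λ f → f [] q qs refl , λ { pre _ _ refl → f (q ∷ pre) _ _ refl })
  (P? [] q ×-dec everyPhrase? (λ pre → P? (q ∷ pre)) qs)

isLZEndLike? : ∀ w qs → Dec (IsLZEndLike w qs)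
isLZEndLike? w qs =
  (all? (λ q → ¬? (≡-dec Bool._≟_ q [])) qs ×-dec ≡-dec Bool._≟_ (concat qs) w)
  ×-dec everyPhrase? validPhrase? qs

extend : Bool → List Str → List (List Str)
extend c []       = [ [ c ] ∷ [] ]
extend c (q ∷ qs) = ([ c ] ∷ q ∷ qs) ∷ ((c ∷ q) ∷ qs) ∷ []

parsings : Str → List (List Str)
parsings []      = [ [] ]
parsings (c ∷ w) = concatMap (extend c) (parsings w)

∈-parsings : ∀ w qs → IsParsing w qs → qs ∈ parsings w
∈-parsings []      []                  _                  = here refl
∈-parsings _       ([] ∷ qs)           (≢[] ∷ _ , _)      = contradiction refl ≢[]
∈-parsings (c ∷ w) ((_ ∷ []) ∷ [])     (_ ∷ _ , refl)     = here refl
∈-parsings (c ∷ w) ((_ ∷ []) ∷ q ∷ qs) (_ ∷ ne , refl)    =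
  ∈-concatMap⁺ (extend c) (lose (∈-parsings w (q ∷ qs) (ne , refl)) (here refl))
∈-parsings (c ∷ w) ((_ ∷ d ∷ q) ∷ qs)  (_ ∷ ne , refl)    =
  ∈-concatMap⁺ (extend c)
    (lose (∈-parsings w ((d ∷ q) ∷ qs) ((λ ()) ∷ ne , refl)) (there (here refl)))

-- A word has finitely many parsings and the condition on them is decidable, so a shortest one
-- exists. The given `qs` is the default of `argmin`, which settles the case of an empty candidate
-- list.
optimal : ∀ {w qs} → IsLZEndLike w qs → ∃ (ZEnd w)
optimal {w} {qs} lz = length best , (best , best-lz , refl) , λ qs′ lz′ →
  f[argmin]≤v⁺ ≤-totalOrder qs candidates
    (inj₂ (lose (∈-filter⁺ (isLZEndLike? w) (∈-parsings w qs′ (proj₁ lz′)) lz′) ≤-refl))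
  where
  candidates = filter (isLZEndLike? w) (parsings w)
  best       = argmin ≤-totalOrder length qs candidates
  best-lz    = argmin-all ≤-totalOrder length lz (all-filter (isLZEndLike? w) (parsings w))

-- Parsings built from left to right

++-compare : ∀ {A : Set} (x {y} u {v} : List A) → x ++ y ≡ u ++ v →
  (∃ λ z → x ≡ u ++ z) ⊎ (∃ λ c → ∃ λ z → x ++ c ∷ z ≡ u × y ≡ c ∷ z ++ v)
++-compare x       []      eq = inj₁ (x , refl)
++-compare []      (c ∷ u) eq = inj₂ (c , u , refl , eq)
++-compare (c ∷ x) (d ∷ u) eq with refl , eq′ ← ∷-injective eq | ++-compare x u (∷-injectiveʳ eq)
... | inj₁ (z , refl)         = inj₁ (z , refl)
... | inj₂ (e , z , refl , y) = inj₂ (e , z , refl , y)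

concat-∷ʳ : ∀ (qs : List Str) q → concat (qs ∷ʳ q) ≡ concat qs ++ q
concat-∷ʳ qs q = trans (sym (concat-++ qs [ q ])) (cong (concat qs ++_) (++-identityʳ q))

length-∷ʳ : ∀ {A : Set} (xs : List A) x → length (xs ∷ʳ x) ≡ suc (length xs)
length-∷ʳ xs x = trans (length-++ xs) (+-comm (length xs) 1)

-- The third argument is the text from the phrase to the end of the word. `GreedyStep` depends on it
-- and `Valid` ignores it, so a single `Parse` record covers both kinds of parsing.
Condition : Set₁
Condition = List Str → Str → Str → Set

Valid : Condition
Valid pre q _ = ValidPhrase pre q

Steps : Condition → List Str → Str → Set
Steps P qs R = ∀ pre q post → qs ≡ pre ++ q ∷ post → P pre q (concat (q ∷ post) ++ R)

steps-∷ʳ : ∀ {P : Condition} {qs q R} → Steps P qs (q ++ R) → P qs q (q ++ R) → Steps P (qs ∷ʳ q) R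
steps-∷ʳ {P} {qs} {q} {R} ps p pre q′ post eq with initLast post
... | [] with refl , refl ← ∷ʳ-injective qs pre eq =
  subst (λ s → P qs q (s ++ R)) (sym (++-identityʳ q)) p
... | post′ ∷ʳ′ r
  with refl , refl ← ∷ʳ-injective qs (pre ++ q′ ∷ post′) (trans eq (sym (++-assoc pre (q′ ∷ post′) [ r ]))) =
  subst (P pre q′) (trans (sym (++-assoc (concat (q′ ∷ post′)) q R))
                          (cong (_++ R) (sym (concat-∷ʳ (q′ ∷ post′) q))))
        (ps pre q′ post′ refl)

record Parse (P : Condition) (w : Str) (qs : List Str) (R : Str) : Set where
  constructor parse
  field
    nonempty : All (_≢ []) qs
    joins    : concat qs ++ R ≡ w
    steps    : Steps P qs R

parse-∷ʳ : ∀ {P w qs q R} → Parse P w qs (q ++ R) → q ≢ [] → P qs q (q ++ R) → Parse P w (qs ∷ʳ q) R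
parse-∷ʳ {P} {w} {qs} {q} {R} (parse ne eq ps) q≢[] p = parse (∷ʳ⁺ ne q≢[])
  (trans (trans (cong (_++ R) (concat-∷ʳ qs q)) (++-assoc (concat qs) q R)) eq)
  (steps-∷ʳ {P} ps p)

greedy⇒valid : ∀ {pre q R} → GreedyStep pre q R → ValidPhrase pre q
greedy⇒valid (inj₁ (c , _ , _ , c∉ , q≡))    = inj₁ (c , q≡ , c∉)
greedy⇒valid (inj₂ (_ , _ , _ , _ , suf , _)) = inj₂ suf

parse-valid : ∀ {w qs R} → Parse GreedyStep w qs R → Parse Valid w qs R
parse-valid (parse ne eq ps) = parse ne eq λ pre q post eq′ → greedy⇒valid (ps pre q post eq′)

parse⇒isLZEndLike : ∀ {w qs} → Parse Valid w qs [] → IsLZEndLike w qs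
parse⇒isLZEndLike {qs = qs} (parse ne eq ps) = (ne , trans (sym (++-identityʳ (concat qs))) eq) , ps

parse⇒isLZEnd : ∀ {w qs} → Parse GreedyStep w qs [] → IsLZEnd w qs
parse⇒isLZEnd {qs = qs} (parse ne eq ps) = (ne , trans (sym (++-identityʳ (concat qs))) eq) ,
  λ pre q post eq′ → subst (GreedyStep pre q) (++-identityʳ (concat (q ∷ post))) (ps pre q post eq′)

-- Phrase ends as sources of copies

EveryEnd : (Str → Set) → List Str → Set
EveryEnd G pre = ∀ i → 1 ≤ i → i ≤ length pre → G (concat (take i pre))

take-∷ʳ : ∀ {A : Set} i (xs : List A) {x} → i ≤ length xs → take i (xs ∷ʳ x) ≡ take i xs
take-∷ʳ zero    xs       _         = refl
take-∷ʳ (suc i) (y ∷ xs) (s≤s i≤) = cong (y ∷_) (take-∷ʳ i xs i≤)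

everyEnd-∷ʳ : ∀ {G pre q} → EveryEnd G pre → G (concat pre ++ q) → EveryEnd G (pre ∷ʳ q)
everyEnd-∷ʳ {G} {pre} {q} gs g i 1≤i i≤ with i ≤? length pre
... | yes i≤pre = subst (G ∘ concat) (sym (take-∷ʳ i pre i≤pre)) (gs i 1≤i i≤pre)
... | no  i≰pre = subst G (sym (trans (cong concat (take-all i (pre ∷ʳ q) len≤i)) (concat-∷ʳ pre q))) g
  where
  len≤i : length (pre ∷ʳ q) ≤ i
  len≤i = subst (_≤ i) (sym (length-∷ʳ pre q)) (≰⇒> i≰pre)

suffix-trans : ∀ {r s t} → Suffix r s → Suffix s t → Suffix r t
suffix-trans {r} (u , refl) (v , refl) = v ++ u , ++-assoc v u r

endSuffix-suffix : ∀ {pre r s} → Suffix r s → EndSuffix pre s → EndSuffix pre r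
endSuffix-suffix r⊑s (i , 1≤i , i≤ , s⊑t) = i , 1≤i , i≤ , suffix-trans r⊑s s⊑t

endSuffix-weaken : ∀ {pre s q} → EndSuffix pre s → EndSuffix (pre ∷ʳ q) s
endSuffix-weaken {pre} {s} {q} (i , 1≤i , i≤ , suf) = i , 1≤i ,
  ≤-trans i≤ (length-++-≤ˡ pre) , subst (Suffix s ∘ concat) (sym (take-∷ʳ i pre i≤)) suf

endSuffix-last : ∀ {pre q s} → Suffix s (concat pre ++ q) → EndSuffix (pre ∷ʳ q) s
endSuffix-last {pre} {q} {s} suf = length (pre ∷ʳ q) ,
  subst (1 ≤_) (sym (length-∷ʳ pre q)) (s≤s z≤n) , ≤-refl ,
  subst (Suffix s) (sym (trans (cong concat (take-all _ (pre ∷ʳ q) ≤-refl)) (concat-∷ʳ pre q))) suf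

concat-take-drop : ∀ i (qs : List Str) → concat (take i qs) ++ concat (drop i qs) ≡ concat qs
concat-take-drop i qs = trans (concat-++ (take i qs) (drop i qs)) (cong concat (take++drop≡id i qs))

endSuffix-∈ : ∀ {pre s c} → c ∈ s → EndSuffix pre s → c ∈ concat pre
endSuffix-∈ {pre} c∈s (i , _ , _ , u , eq) =
  subst (_ ∈_) (concat-take-drop i pre) (∈-++⁺ˡ (subst (_ ∈_) eq (∈-++⁺ʳ u c∈s)))

endSuffix-length : ∀ {pre s} → EndSuffix pre s → length s ≤ length (concat pre)
endSuffix-length {pre} {s} (i , _ , _ , u , eq) = begin
  length s                                            ≤⟨ length-++-≤ʳ s {u} ⟩
  length (u ++ s)                                     ≡⟨ cong length eq ⟩
  length (concat (take i pre))                        ≤⟨ length-++-≤ˡ (concat (take i pre)) ⟩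
  length (concat (take i pre) ++ concat (drop i pre)) ≡⟨ cong length (concat-take-drop i pre) ⟩
  length (concat pre)                                 ∎
  where open ≤-Reasoning

greedyCopy : ∀ {pre R} q → q ≢ [] → EndSuffix pre q →
  (∀ p → Prefix p (q ++ R) → EndSuffix pre p → length p ≤ length q) → GreedyStep pre q (q ++ R)
greedyCopy []      q≢[] _   _   = contradiction refl q≢[]
greedyCopy (c ∷ q) _    suf max = inj₂ (c , _ , refl , endSuffix-∈ (here refl) suf , suf , max)

-- Words as sequences of runs

a^_ : ℕ → Str
a^ r = replicate r false

-- Each run is closed by a b, so an encoded word is empty or ends in b; a run of length 0 after
-- another run produces bb.
enc : List ℕ → Str
enc []       = []
enc (r ∷ rs) = a^ r ++ true ∷ enc rs

a^-+ : ∀ x y → a^ (x + y) ≡ a^ x ++ a^ y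
a^-+ zero    y = refl
a^-+ (suc x) y = cong (false ∷_) (a^-+ x y)

true∉a^ : ∀ r → true ∉ a^ r
true∉a^ (suc r) (there t∈) = true∉a^ r t∈

enc-++ : ∀ rs ss → enc (rs ++ ss) ≡ enc rs ++ enc ss
enc-++ []       ss = refl
enc-++ (r ∷ rs) ss = trans (cong (λ s → a^ r ++ true ∷ s) (enc-++ rs ss))
                           (sym (++-assoc (a^ r) (true ∷ enc rs) (enc ss)))

enc-∷ʳ : ∀ rs r → enc (rs ∷ʳ r) ≡ (enc rs ++ a^ r) ∷ʳ true
enc-∷ʳ rs r = trans (enc-++ rs [ r ]) (sym (++-assoc (enc rs) (a^ r) [ true ]))

run-injective : ∀ r s {x y} → a^ r ++ true ∷ x ≡ a^ s ++ true ∷ y → r ≡ s × x ≡ y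
run-injective zero    zero    refl = refl , refl
run-injective (suc r) (suc s) eq with run-injective r s (∷-injectiveʳ eq)
... | refl , x≡y = refl , x≡y

enc-∷⁻ : ∀ r {x} gs → a^ r ++ true ∷ x ≡ enc gs → ∃ λ hs → gs ≡ r ∷ hs × x ≡ enc hs
enc-∷⁻ r []       eq with () ← ++-conicalʳ (a^ r) _ eq
enc-∷⁻ r (g ∷ gs) eq with refl , x≡ ← run-injective r g eq = gs , refl , x≡

enc-prefix : ∀ gs rs {z} → enc gs ++ z ≡ enc rs → ∃ λ hs → gs ++ hs ≡ rs
enc-prefix []       rs     _  = rs , refl
enc-prefix (g ∷ gs) rs {z} eq
  with hs , refl , eq′ ← enc-∷⁻ g rs (trans (sym (++-assoc (a^ g) (true ∷ enc gs) z)) eq)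
  with ks , refl ← enc-prefix gs hs eq′ = ks , refl

enc-last : ∀ es x {d} → x ∷ʳ d ≡ enc es → d ≡ true
enc-last es x eq with reverseView es
... | []           with () ← ++-conicalʳ x _ eq
... | fs ∶ _ ∶ʳ f = ∷ʳ-injectiveʳ x _ (trans eq (enc-∷ʳ fs f))

run-split : ∀ e x {y t} → a^ e ++ true ∷ t ≡ x ++ true ∷ y →
  (x ≡ a^ e × t ≡ y) ⊎ (∃ λ x′ → x ≡ a^ e ++ true ∷ x′ × t ≡ x′ ++ true ∷ y)
run-split zero    []      refl = inj₁ (refl , refl)
run-split zero    (_ ∷ x) refl = inj₂ (x , refl , refl)
run-split (suc e) (_ ∷ x) eq with refl , eq′ ← ∷-injective eq | run-split e x (∷-injectiveʳ eq)
... | inj₁ (refl , t≡)      = inj₁ (refl , t≡)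
... | inj₂ (x′ , refl , t≡) = inj₂ (x′ , refl , t≡)

-- The marked b closes some run `f` of `es`, and `x` stops just before it.
enc-split : ∀ es x {y} → enc es ≡ x ++ true ∷ y →
  ∃ λ fs → ∃ λ f → ∃ λ gs → es ≡ fs ++ f ∷ gs × x ≡ enc fs ++ a^ f × y ≡ enc gs
enc-split []       x eq with () ← ++-conicalʳ x _ (sym eq)
enc-split (e ∷ es) x eq with run-split e x eq
... | inj₁ (refl , refl) = [] , e , es , refl , refl , refl
... | inj₂ (x′ , refl , eq′) with enc-split es x′ eq′
...   | fs , f , gs , refl , refl , refl =
  e ∷ fs , f , gs , refl , sym (++-assoc (a^ e) (true ∷ enc fs) (a^ f)) , refl

++-a^-suc : ∀ u r → u ++ a^ suc r ≡ (u ++ a^ r) ∷ʳ false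
++-a^-suc u r = trans (cong (u ++_) (trans (cong a^_ (+-comm 1 r)) (a^-+ r 1)))
                      (sym (++-assoc u (a^ r) [ false ]))

-- The right-hand word has exactly `f` trailing a's, since `enc fs` is empty or ends in b. The
-- induction strips them one at a time.
last-run-≤ : ∀ r f u fs → u ++ a^ r ≡ enc fs ++ a^ f → r ≤ f
last-run-≤ zero    f       u fs eq = z≤n
last-run-≤ (suc r) zero    u fs eq
  with () ← enc-last fs (u ++ a^ r) (trans (sym (++-a^-suc u r)) (trans eq (++-identityʳ (enc fs))))
last-run-≤ (suc r) (suc f) u fs eq = s≤s (last-run-≤ r f u fs
  (∷ʳ-injectiveˡ _ _ (trans (sym (++-a^-suc u r)) (trans eq (++-a^-suc (enc fs) f)))))

-- A phrase v b cannot be prolonged into the following runs rs by a copy of a suffix of the text t.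
Blocked : Str → List ℕ → Str → Set
Blocked v rs t = true ∉ t ⊎ ∃ λ es → t ≡ enc es × (∀ fs f g gs u →
  es ≡ fs ++ f ∷ g ∷ gs → u ++ v ≡ enc fs ++ a^ f → (∃ λ hs → g ∷ gs ++ hs ≡ rs) → ⊥)

-- A longer copy `p` reads v b followed by at least one letter. Its source ends in b, so what
-- follows v b in it consists of whole runs, at least one, and these begin `rs`. That is what
-- `Blocked` excludes.
blocked-longest : ∀ {pre} v rs → EveryEnd (Blocked v rs) pre →
  ∀ p → Prefix p (v ∷ʳ true ++ enc rs) → EndSuffix pre p → length p ≤ length (v ∷ʳ true)
blocked-longest v rs bs p (s , eq) (i , 1≤i , i≤ , u , u++p≡t)
  with ++-compare (v ∷ʳ true) p (sym eq)
... | inj₁ (z , vb≡) = subst (length p ≤_) (cong length (sym vb≡)) (length-++-≤ˡ p)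
... | inj₂ (c , z , refl , R≡) with bs i 1≤i i≤
...   | inj₁ b∉t = ⊥-elim (b∉t (subst (true ∈_) u++p≡t
          (∈-++⁺ʳ u (∈-++⁺ˡ (∈-++⁺ʳ v (here refl))))))
...   | inj₂ (es , t≡ , block)
  with enc-split es (u ++ v) (trans (sym (trans u++p≡t t≡))
         (trans (cong (u ++_) (++-assoc v [ true ] (c ∷ z))) (sym (++-assoc u v (true ∷ c ∷ z)))))
...   | fs , f , g ∷ gs , es≡ , uv≡ , cz≡ =
  ⊥-elim (block fs f g gs u es≡ uv≡ (enc-prefix (g ∷ gs) rs (trans (cong (_++ s) (sym cz≡)) (sym R≡))))

∷ʳ≢[] : ∀ {A : Set} (xs : List A) {x} → xs ∷ʳ x ≢ []
∷ʳ≢[] xs eq with () ← ++-conicalʳ xs _ eq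

greedy-∷ʳ : ∀ {w pre v rs} → Parse GreedyStep w pre (v ++ true ∷ enc rs) → EndSuffix pre (v ∷ʳ true) →
  EveryEnd (Blocked v rs) pre → Parse GreedyStep w (pre ∷ʳ (v ∷ʳ true)) (enc rs)
greedy-∷ʳ {w} {pre} {v} {rs} ps suf bs = parse-∷ʳ
  (subst (Parse GreedyStep w pre) (sym (++-assoc v [ true ] (enc rs))) ps) (∷ʳ≢[] v)
  (greedyCopy (v ∷ʳ true) (∷ʳ≢[] v) suf (blocked-longest v rs bs))

-- The initial run

doubling : ℕ → List Str
doubling zero    = [ [ false ] ]
doubling (suc k) = doubling k ∷ʳ a^ (2 ^ k)

a^-double : ∀ k → a^ (2 ^ suc k) ≡ a^ (2 ^ k) ++ a^ (2 ^ k)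

a^-double k = trans (a^-+ (2 ^ k) (2 ^ k + 0)) (cong (λ x → a^ (2 ^ k) ++ a^ x) (+-identityʳ (2 ^ k)))

concat-doubling : ∀ k → concat (doubling k) ≡ a^ (2 ^ k)
concat-doubling zero    = refl
concat-doubling (suc k) = trans (concat-∷ʳ (doubling k) (a^ (2 ^ k)))
  (trans (cong (_++ a^ (2 ^ k)) (concat-doubling k)) (sym (a^-double k)))

length-doubling : ∀ k → length (doubling k) ≡ suc k
length-doubling zero    = refl
length-doubling (suc k) = trans (length-∷ʳ (doubling k) _) (cong suc (length-doubling k))

a^2^k≢[] : ∀ k → a^ (2 ^ k) ≢ []
a^2^k≢[] k with 2 ^ k | m^n>0 2 k
... | suc _ | _ = λ ()

endSuffix-doubling : ∀ k → EndSuffix (doubling k) (a^ (2 ^ k))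
endSuffix-doubling k = length (doubling k) , subst (1 ≤_) (sym (length-doubling k)) (s≤s z≤n) , ≤-refl ,
  [] , sym (trans (cong concat (take-all _ (doubling k) ≤-refl)) (concat-doubling k))

-- Each phrase after the first repeats the whole text read so far. No copy can be longer than its
-- source, so maximality holds whatever `X` is.
parse-doubling : ∀ k X → Parse GreedyStep (a^ (2 ^ k) ++ X) (doubling k) X
parse-doubling zero    X = parse-∷ʳ {qs = []} (parse [] refl λ { [] _ _ () ; (_ ∷ _) _ _ () })
  (λ ()) (inj₁ (false , X , refl , (λ ()) , refl))
parse-doubling (suc k) X = parse-∷ʳ
  (subst (λ w → Parse GreedyStep w (doubling k) (a^ (2 ^ k) ++ X))
         (trans (sym (++-assoc (a^ (2 ^ k)) _ X)) (cong (_++ X) (sym (a^-double k))))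
         (parse-doubling k (a^ (2 ^ k) ++ X)))
  (a^2^k≢[] k)
  (greedyCopy (a^ (2 ^ k)) (a^2^k≢[] k) (endSuffix-doubling k)
    λ p _ suf → subst (λ s → length p ≤ length s) (concat-doubling k) (endSuffix-length suf))

everyEnd-doubling : ∀ k → EveryEnd (true ∉_) (doubling k)
everyEnd-doubling k i _ _ t∈ = true∉a^ (2 ^ k) (subst (true ∈_)
  (trans (concat-take-drop i (doubling k)) (concat-doubling k)) (∈-++⁺ˡ t∈))

-- The word and its greedy parsing

-- The units with exponents from `j + 1` to `j + d`.
units : ℕ → ℕ → List ℕ
units j zero    = []
units j (suc d) = suc j ∷ 0 ∷ units (suc j) d

units-suc : ∀ j d → units j (suc d) ≡ units j d ++ suc (j + d) ∷ 0 ∷ []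
units-suc j zero    = cong (λ x → suc x ∷ 0 ∷ []) (sym (+-identityʳ j))
units-suc j (suc d) = cong (λ us → suc j ∷ 0 ∷ us)
  (trans (units-suc (suc j) d) (cong (λ x → units (suc j) d ++ suc x ∷ 0 ∷ []) (sym (+-suc j d))))

runs : ℕ → ℕ → List ℕ
runs m n = m ∷ m ∷ 0 ∷ m ∷ units 0 n

RunsWithin : ℕ → ℕ → List ℕ → Set
RunsWithin m j es = All (λ e → e ≤ j ⊎ e ≡ m) es

within-∷ʳ : ∀ {m j es e} → RunsWithin m j es → e ≤ suc j → RunsWithin m (suc j) (es ∷ʳ e)
within-∷ʳ ok e≤ = ∷ʳ⁺ (All.map [ inj₁ ∘ m≤n⇒m≤1+n , inj₂ ]′ ok) (inj₁ e≤)

within-units : ∀ m j → RunsWithin m j (runs m j)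
within-units m j = inj₂ refl ∷ inj₂ refl ∷ inj₁ z≤n ∷ inj₂ refl ∷ go 0 j
  where
  go : ∀ i d → All (λ e → e ≤ i + d ⊎ e ≡ m) (units i d)
  go i zero    = []
  go i (suc d) = inj₁ (subst (suc i ≤_) (sym (+-suc i d)) (s≤s (m≤m+n i d))) ∷ inj₁ z≤n ∷
    subst (λ x → All (λ e → e ≤ x ⊎ e ≡ m) (units (suc i) d)) (sym (+-suc i d)) (go (suc i) d)

fresh : ∀ {m j es} → suc j < m → RunsWithin m j es → suc j ∉ es
fresh j<m ok j∈ with All.lookup ok j∈
... | inj₁ j≤ = 1+n≰n j≤
... | inj₂ refl = <-irrefl refl j<m

-- What greedy phrase ends look like after j units; the last clause is what prevents
-- a^(j+1) bb from being copied as a whole.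
End : ℕ → ℕ → Str → Set
End m j t = true ∉ t ⊎ ∃ λ es → t ≡ enc es × RunsWithin m j es ×
  (∀ fs e → es ≡ fs ++ e ∷ 0 ∷ [] → e ≤ j)

end-suc : ∀ {m j t} → End m j t → End m (suc j) t
end-suc (inj₁ b∉)                     = inj₁ b∉
end-suc (inj₂ (es , t≡ , ok , zeros)) = inj₂ (es , t≡ , All.map [ inj₁ ∘ m≤n⇒m≤1+n , inj₂ ]′ ok ,
  λ fs e eq → m≤n⇒m≤1+n (zeros fs e eq))

-- Going past the phrase would require a source with a run of length `j + 1`, which is still absent;
-- with no unit left there is nothing to go into.
end⇒blocked-units : ∀ {m v t} j d → j + d < m → End m j t → Blocked v (units j d) t
end⇒blocked-units j d       j<m (inj₁ b∉)                 = inj₁ b∉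
end⇒blocked-units j zero    j<m (inj₂ (es , t≡ , _))      = inj₂ (es , t≡ , λ { _ _ _ _ _ _ _ (_ , ()) })
end⇒blocked-units {m} j (suc d) j<m (inj₂ (es , t≡ , ok , _)) = inj₂ (es , t≡ , λ
  { fs f g gs u refl _ (_ , gs⊑) → fresh (≤-<-trans (m≤m+n (suc j) d) (subst (_< m) (+-suc j d) j<m)) ok
      (∈-++⁺ʳ fs (there (here (sym (∷-injectiveˡ gs⊑))))) })

-- There are two ways to prolong a^(j+1) b. Adding just the second b needs a source ending in a run
-- of length at least `j + 1` followed by 0, against the last clause of `End`. Going further needs a
-- run of length `j + 2`, which is absent too.
end⇒blocked-zero : ∀ {m t} j d → suc j + d < m → End m j t → Blocked (a^ suc j) (0 ∷ units (suc j) d) t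
end⇒blocked-zero j d j<m (inj₁ b∉) = inj₁ b∉
end⇒blocked-zero {m} j d j<m (inj₂ (es , t≡ , ok , zeros)) = inj₂ (es , t≡ , block d j<m)
  where
  block : ∀ d → suc j + d < m → ∀ fs f g gs u → es ≡ fs ++ f ∷ g ∷ gs → u ++ a^ suc j ≡ enc fs ++ a^ f →
    (∃ λ hs → g ∷ gs ++ hs ≡ 0 ∷ units (suc j) d) → ⊥
  block d       _   fs f _ []      u eq run (_ , refl) =
    1+n≰n (≤-trans (last-run-≤ (suc j) f u fs run) (zeros fs f eq))
  block (suc d) j<m fs f _ (_ ∷ _) u eq run (_ , gs⊑) =
    fresh (≤-<-trans (m≤m+n (suc (suc j)) d) (subst (_< m) (+-suc (suc j) d) j<m))
      (All.map [ inj₁ ∘ m≤n⇒m≤1+n , inj₂ ]′ ok)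
      (subst (suc (suc j) ∈_) (sym eq)
        (∈-++⁺ʳ fs (there (there (here (sym (∷-injectiveˡ (∷-injectiveʳ gs⊑))))))))

-- Parsing the units

last-two : ∀ (xs : List ℕ) {r s} fs e → xs ∷ʳ r ≡ fs ++ e ∷ s ∷ [] → xs ≡ fs ∷ʳ e × r ≡ s
last-two xs {s = s} fs e eq = ∷ʳ-injective xs (fs ∷ʳ e) (trans eq (sym (++-assoc fs [ e ] [ s ])))

b⊑ : ∀ v → Suffix [ true ] (v ∷ʳ true)
b⊑ v = v , refl

run⊑ : ∀ {r m} s → r ≤ m → Suffix (a^ r ++ s) (a^ m ++ s)
run⊑ {r} {m} s r≤m = a^ (m ∸ r) , trans (sym (++-assoc (a^ (m ∸ r)) (a^ r) s))
  (cong (_++ s) (trans (sym (a^-+ (m ∸ r) r)) (cong a^_ (m∸n+n≡m r≤m))))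

-- The one source a^m bb serves every unit, because all exponents stay below `m`.
optimal-units : ∀ {w m} j d {pre} → j + d < m → Parse Valid w pre (enc (units j d)) →
  EndSuffix pre (a^ m ++ true ∷ true ∷ []) →
  ∃ λ qs → Parse Valid w qs [] × length qs ≡ length pre + d
optimal-units j zero    {pre} _ ps _ = pre , ps , sym (+-identityʳ (length pre))
optimal-units {w} {m} j (suc d) {pre} j<m ps suf =
  let qs , ps′ , len = optimal-units {w} {m} (suc j) d {pre ∷ʳ (a^ suc j ++ true ∷ true ∷ [])} j<m′
        (parse-∷ʳ (subst (Parse Valid w pre)
            (sym (++-assoc (a^ suc j) (true ∷ true ∷ []) (enc (units (suc j) d)))) ps)
          (λ ())
          (inj₂ (endSuffix-suffix (run⊑ _ (≤-trans (m≤m+n (suc j) d) (<⇒≤ j<m′))) suf)))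
        (endSuffix-weaken suf)
  in qs , ps′ , trans len (trans (cong (_+ d) (length-∷ʳ pre _)) (sym (+-suc (length pre) d)))
  where
  j<m′ : suc j + d < m
  j<m′ = subst (_< m) (+-suc j d) j<m

-- Each unit costs two phrases: a^(j+1) b, copied from the end of a^m b, and then b alone. The `End`
-- invariant at `j` makes the first maximal, and the one at `j + 1` makes the second maximal.
greedy-units : ∀ {w m} j d {pre es} → j + d < m → Parse GreedyStep w pre (enc (units j d)) →
  concat pre ≡ enc es → RunsWithin m j es → EveryEnd (End m j) pre → EndSuffix pre (a^ m ∷ʳ true) →
  ∃ λ qs → Parse GreedyStep w qs [] × length qs ≡ length pre + 2 * d
greedy-units j zero    {pre} _ ps _ _ _ _ = pre , ps , sym (+-identityʳ (length pre))
greedy-units {w} {m} j (suc d) {pre} {es} j<m ps pre≡ ok ends suf =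
  let qs , ps′ , len = greedy-units {w} {m} (suc j) d {pre₂} {es₂} j<m′
        (greedy-∷ʳ {v = []} (greedy-∷ʳ {v = a^ suc j} ps
            (endSuffix-suffix (run⊑ [ true ] (≤-trans (m≤m+n (suc j) d) (<⇒≤ j<m′))) suf)
            (λ i 1≤i i≤ → end⇒blocked-zero j d j<m′ (ends i 1≤i i≤)))
          (endSuffix-suffix (b⊑ (a^ m)) (endSuffix-weaken suf))
          (λ i 1≤i i≤ → end⇒blocked-units (suc j) d j<m′ (ends₁ i 1≤i i≤)))
        pre₂≡ ok₂ ends₂ (endSuffix-weaken (endSuffix-weaken suf))
  in qs , ps′ , trans len (trans (cong (_+ 2 * d) (trans (length-∷ʳ pre₁ _) (cong suc (length-∷ʳ pre _))))
                                (arith (length pre) d))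
  where
  j<m′ : suc j + d < m
  j<m′ = subst (_< m) (+-suc j d) j<m
  es₁ = es ∷ʳ suc j
  es₂ = es₁ ∷ʳ 0
  pre₁ = pre ∷ʳ (a^ suc j ∷ʳ true)
  pre₂ = pre₁ ∷ʳ [ true ]
  text₁≡ : concat pre ++ a^ suc j ∷ʳ true ≡ enc es₁
  text₁≡ = trans (cong (_++ a^ suc j ∷ʳ true) pre≡) (sym (enc-++ es [ suc j ]))
  pre₁≡ : concat pre₁ ≡ enc es₁
  pre₁≡ = trans (concat-∷ʳ pre _) text₁≡
  text₂≡ : concat pre₁ ++ [ true ] ≡ enc es₂
  text₂≡ = trans (cong (_++ [ true ]) pre₁≡) (sym (enc-++ es₁ [ 0 ]))
  pre₂≡ : concat pre₂ ≡ enc es₂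
  pre₂≡ = trans (concat-∷ʳ pre₁ _) text₂≡
  ok₁ : RunsWithin m (suc j) es₁
  ok₁ = within-∷ʳ ok ≤-refl
  ok₂ : RunsWithin m (suc j) es₂
  ok₂ = ∷ʳ⁺ ok₁ (inj₁ z≤n)
  ends₁ : EveryEnd (End m (suc j)) pre₁
  ends₁ = everyEnd-∷ʳ {End m (suc j)} (λ i 1≤i i≤ → end-suc (ends i 1≤i i≤))
    -- This text ends in a run of length `j + 1`, not 0, so the last clause of `End` is vacuous.
    (inj₂ (es₁ , text₁≡ , ok₁ , λ fs e eq →
      case proj₂ (last-two es fs e eq) of λ ()))
  ends₂ : EveryEnd (End m (suc j)) pre₂
  ends₂ = everyEnd-∷ʳ {End m (suc j)} ends₁
    -- This text does end in the runs `j + 1`, 0; the bound in `End` has risen to `j + 1` just in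
    -- time.
    (inj₂ (es₂ , text₂≡ , ok₂ , λ fs e eq →
      ≤-reflexive (sym (∷ʳ-injectiveʳ es fs (proj₁ (last-two es₁ fs e eq))))))
  arith : ∀ x d → suc (suc x) + 2 * d ≡ x + 2 * suc d
  arith = solve-∀

-- Lower bound: the factor b a^j b is new when it first occurs, so no phrase contains it.

valid-∷ʳ : ∀ {qs q} → (∀ pre r post → qs ∷ʳ q ≡ pre ++ r ∷ post → ValidPhrase pre r) →
  ∀ pre r post → qs ≡ pre ++ r ∷ post → ValidPhrase pre r
valid-∷ʳ {q = q} valid pre r post refl = valid pre r (post ∷ʳ q) (++-assoc pre (r ∷ post) [ q ])

-- What lies between two consecutive b's is a complete run, hence an entry of `es`.
no-factor : ∀ x r y es → r ∉ es → enc es ≢ x ++ true ∷ a^ r ++ true ∷ y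
no-factor x r y es r∉ eq with fs , f , gs , refl , _ , eq′ ← enc-split es x eq
  with hs , refl , _ ← enc-∷⁻ r gs eq′ = r∉ (∈-++⁺ʳ fs (there (here refl)))

-- `z` is the part of the phrase inside the old text `enc es`. Being non-empty it ends in b, so the
-- phrase contains b a^r b. It is then no single symbol, and as a copy it would put this factor into
-- `concat pre`, hence into `enc es`.
phrase-no-factor : ∀ {pre z y es} r → z ≢ [] → concat pre ++ z ≡ enc es → r ∉ es →
  ¬ ValidPhrase pre (z ++ a^ r ++ true ∷ y)
phrase-no-factor {z = []} r z≢[] _ _ _ = z≢[] refl
phrase-no-factor {z = _ ∷ z} r _ _ _ (inj₁ (_ , eq , _))
  with () ← ++-conicalʳ (a^ r) _ (++-conicalʳ z _ (∷-injectiveʳ eq))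
phrase-no-factor {pre} {z} {y} {es} r z≢[] eq r∉ (inj₂ (i , _ , _ , u , suf)) with initLast z
... | [] = z≢[] refl
... | z′ ∷ʳ′ d with refl ← enc-last es (concat pre ++ z′) (trans (++-assoc (concat pre) z′ [ d ]) eq) =
  no-factor (u ++ z′) r (y ++ rest) es r∉ (begin
    enc es                                                   ≡⟨ eq ⟨
    concat pre ++ z′ ∷ʳ true                                 ≡⟨ cong (_++ z′ ∷ʳ true) (concat-take-drop i pre) ⟨
    (concat (take i pre) ++ dropped) ++ z′ ∷ʳ true           ≡⟨ ++-assoc (concat (take i pre)) dropped _ ⟩
    concat (take i pre) ++ rest                              ≡⟨ cong (_++ rest) suf ⟨
    (u ++ z′ ∷ʳ true ++ a^ r ++ true ∷ y) ++ rest            ≡⟨ ++-assoc u _ rest ⟩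
    u ++ (z′ ∷ʳ true ++ a^ r ++ true ∷ y) ++ rest            ≡⟨ cong (u ++_) (++-assoc (z′ ∷ʳ true) _ rest) ⟩
    u ++ z′ ∷ʳ true ++ (a^ r ++ true ∷ y) ++ rest            ≡⟨ cong (u ++_) (++-assoc z′ [ true ] _) ⟩
    u ++ z′ ++ true ∷ (a^ r ++ true ∷ y) ++ rest             ≡⟨ ++-assoc u z′ _ ⟨
    (u ++ z′) ++ true ∷ (a^ r ++ true ∷ y) ++ rest           ≡⟨ cong (λ s → (u ++ z′) ++ true ∷ s) (++-assoc (a^ r) _ rest) ⟩
    (u ++ z′) ++ true ∷ a^ r ++ true ∷ y ++ rest             ∎)
  where
  open ≡-Reasoning
  dropped = concat (drop i pre)
  rest    = dropped ++ z′ ∷ʳ true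

enc-runs-suc : ∀ m j → enc (runs m (suc j)) ≡ enc (runs m j) ++ a^ suc j ++ true ∷ true ∷ []
enc-runs-suc m j = trans (cong (λ us → enc (m ∷ m ∷ 0 ∷ m ∷ us)) (units-suc 0 j))
                         (enc-++ (runs m j) (suc j ∷ 0 ∷ []))

-- Induction on `j`, removing the last phrase. If that phrase began inside `enc (runs m j)`, it
-- would contain the new factor b a^(j+1) b; so the other phrases already cover `enc (runs m j)`.
-- The surplus `y` is there because phrases need not end where units do.
phrases-≥ : ∀ {m pre y} j → Reverse pre → (∀ xs q post → pre ≡ xs ++ q ∷ post → ValidPhrase xs q) →
  j < m → concat pre ≡ enc (runs m j) ++ y → j ≤ length pre
phrases-≥     zero    _  _     _   _  = z≤n
phrases-≥ {m} (suc j) [] valid j<m eq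
  with () ← ++-conicalʳ (a^ m) _ (++-conicalˡ (enc (runs m (suc j))) _ (sym eq))
phrases-≥ {m} {_} {y} (suc j) (qs ∶ rev ∶ʳ q) valid j<m eq = subst (suc j ≤_) (sym (length-∷ʳ qs q)) (s≤s step)
  where
  eq′ : concat qs ++ q ≡ enc (runs m j) ++ a^ suc j ++ true ∷ true ∷ y
  eq′ = trans (sym (concat-∷ʳ qs q)) (trans eq (trans (cong (_++ y) (enc-runs-suc m j))
    (trans (++-assoc (enc (runs m j)) _ y) (cong (enc (runs m j) ++_) (++-assoc (a^ suc j) _ y)))))
  step : j ≤ length qs
  step with ++-compare (concat qs) (enc (runs m j)) eq′
  ... | inj₁ (z , qs≡) = phrases-≥ j rev (valid-∷ʳ valid) (<-trans (n<1+n j) j<m) qs≡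
  ... | inj₂ (c , z , runs≡ , refl) = ⊥-elim
    (phrase-no-factor (suc j) (λ ()) runs≡ (fresh j<m (within-units m j)) (valid qs _ [] refl))

-- Sizes of the two parsings of the whole word

module Word (k n : ℕ) (n<m : n < 2 ^ k) where

  m : ℕ
  m = 2 ^ k

  word : Str
  word = enc (runs m n)

  pre₁ pre₂ pre₃ : List Str
  pre₁ = doubling k ∷ʳ [ true ]
  pre₂ = pre₁ ∷ʳ (a^ m ∷ʳ true)
  pre₃ = pre₂ ∷ʳ (true ∷ a^ m ∷ʳ true)

  length-pre₂ : length pre₂ ≡ k + 3
  length-pre₂ = trans (length-∷ʳ pre₁ _) (trans (cong suc (trans (length-∷ʳ (doubling k) _)
    (cong suc (length-doubling k)))) (+-comm 3 k))

  text₁≡ : concat (doubling k) ++ [ true ] ≡ enc (m ∷ [])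
  text₁≡ = cong (_++ [ true ]) (concat-doubling k)

  text₂≡ : concat pre₁ ++ a^ m ∷ʳ true ≡ enc (m ∷ m ∷ [])
  text₂≡ = trans (cong (_++ a^ m ∷ʳ true) (trans (concat-∷ʳ (doubling k) _) text₁≡))
                 (sym (enc-++ (m ∷ []) (m ∷ [])))

  text₃≡ : concat pre₂ ++ true ∷ a^ m ∷ʳ true ≡ enc (m ∷ m ∷ 0 ∷ m ∷ [])
  text₃≡ = trans (cong (_++ true ∷ a^ m ∷ʳ true) (trans (concat-∷ʳ pre₁ _) text₂≡))
                 (sym (enc-++ (m ∷ m ∷ []) (0 ∷ m ∷ [])))

  suf₁ : EndSuffix pre₁ (a^ m ∷ʳ true)
  suf₁ = endSuffix-last {doubling k} ([] , sym text₁≡)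

  parse₂ : Parse GreedyStep word pre₂ (enc (0 ∷ m ∷ units 0 n))
  parse₂ = greedy-∷ʳ {v = a^ m} {0 ∷ m ∷ units 0 n} (parse-∷ʳ {q = [ true ]} (parse-doubling k _) (λ ())
      (inj₁ (true , _ , refl , subst (true ∉_) (sym (concat-doubling k)) (true∉a^ m) , refl)))
    suf₁
    (everyEnd-∷ʳ {Blocked (a^ m) _} (λ i 1≤i i≤ → inj₁ (everyEnd-doubling k i 1≤i i≤))
      -- The text a^m b has a single run, so nothing follows its b that could be copied.
      (inj₂ (m ∷ [] , text₁≡ , λ { [] _ _ _ _ () ; (_ ∷ []) _ _ _ _ () ; (_ ∷ _ ∷ _) _ _ _ _ () })))

  0<m : 0 < m
  0<m = m^n>0 2 k

  m≢0 : ∀ xs fs e → xs ∷ʳ m ≡ fs ++ e ∷ 0 ∷ [] → e ≤ 0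
  m≢0 xs fs e eq = contradiction (sym (proj₂ (last-two xs fs e eq))) (<⇒≢ 0<m)

  ends₂ : EveryEnd (End m 0) pre₂
  ends₂ = everyEnd-∷ʳ {End m 0} (everyEnd-∷ʳ {End m 0}
      (λ i 1≤i i≤ → inj₁ (everyEnd-doubling k i 1≤i i≤))
      (inj₂ (m ∷ [] , text₁≡ , inj₂ refl ∷ [] , m≢0 [])))
    (inj₂ (m ∷ m ∷ [] , text₂≡ , inj₂ refl ∷ inj₂ refl ∷ [] , m≢0 (m ∷ [])))

  ends₃ : EveryEnd (End m 0) pre₃
  ends₃ = everyEnd-∷ʳ {End m 0} ends₂
    (inj₂ (m ∷ m ∷ 0 ∷ m ∷ [] , text₃≡ , within-units m 0 , m≢0 (m ∷ m ∷ 0 ∷ [])))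

  greedyParse : ∃ λ qs → Parse GreedyStep word qs [] × length qs ≡ length pre₃ + 2 * n
  greedyParse = greedy-units 0 n n<m
    -- The source of b a^m b is the text a^m b a^m b, which is why the word opens with two equal
    -- runs.
    (greedy-∷ʳ {v = true ∷ a^ m} parse₂ (endSuffix-last {pre₁} (a^ m , sym text₂≡))
      (λ i 1≤i i≤ → end⇒blocked-units 0 n n<m (ends₂ i 1≤i i≤)))
    (trans (concat-∷ʳ pre₂ _) text₃≡) (within-units m 0) ends₃ (endSuffix-weaken (endSuffix-weaken suf₁))

  greedySize : ZE word (k + 4 + 2 * n)
  greedySize with qs , ps , len ← greedyParse = qs , parse⇒isLZEnd ps ,
    trans len (cong (_+ 2 * n) (trans (length-∷ʳ pre₂ _) (trans (cong suc length-pre₂) (sym (+-suc k 3)))))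

  -- Up to `pre₂` this follows greedy. Then b is taken alone, which creates a phrase end after a^m
  -- bb at the price of one extra phrase.
  shortParse : ∃ λ qs → Parse Valid word qs [] × length qs ≡ length (pre₂ ∷ʳ [ true ] ∷ʳ (a^ m ∷ʳ true)) + n
  shortParse = optimal-units 0 n n<m
    (parse-∷ʳ
      (subst (Parse Valid word (pre₂ ∷ʳ [ true ])) (sym (++-assoc (a^ m) [ true ] (enc (units 0 n))))
        (parse-∷ʳ {q = [ true ]} (parse-valid parse₂) (λ ())
          (inj₂ (endSuffix-suffix (b⊑ (a^ m)) (endSuffix-weaken suf₁)))))
      (∷ʳ≢[] (a^ m)) (inj₂ (endSuffix-weaken (endSuffix-weaken suf₁))))
    (endSuffix-weaken (endSuffix-last {pre₂} (a^ m ∷ʳ true ,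
      trans (++-assoc (a^ m) [ true ] _) (sym (trans (cong (_++ [ true ]) (trans (concat-∷ʳ pre₁ _) text₂≡))
        (sym (enc-++ (m ∷ m ∷ []) (0 ∷ []))))))))

  optimalSize : ∃ λ z → ZEnd word z × n ≤ z × z ≤ k + 5 + n
  optimalSize =
    let qs , ps , len = shortParse
        lz = parse⇒isLZEndLike ps
        z , zend@((best , best-lz , best≡) , minimal) = optimal lz
    in z , zend ,
       subst (n ≤_) best≡ (phrases-≥ n (reverseView best) (proj₂ best-lz) n<m
         (trans (proj₂ (proj₁ best-lz)) (sym (++-identityʳ word)))) ,
       ≤-trans (minimal qs lz) (≤-reflexive (trans len (cong (_+ n) (trans (length-∷ʳ (pre₂ ∷ʳ [ true ]) _)
         (trans (cong suc (length-∷ʳ pre₂ _)) (trans (cong (2 +_) length-pre₂) (arith k)))))))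
    where
    arith : ∀ k → 2 + (k + 3) ≡ k + 5
    arith = solve-∀

-- Asymptotics

∣-∣≤ : ∀ {x y c} → x ≤ y + c → y ≤ x + c → ∣ x - y ∣ ≤ c
∣-∣≤ {x} {y} x≤ y≤ with ≤-total x y
... | inj₁ x≤y = subst (_≤ _) (sym (m≤n⇒∣m-n∣≡n∸m x≤y)) (m≤n+o⇒m∸n≤o y x y≤)
... | inj₂ y≤x = subst (_≤ _) (sym (m≤n⇒∣n-m∣≡n∸m y≤x)) (m≤n+o⇒m∸n≤o x y x≤)

-- The induction starts at 4, where both sides are 16; at 3 the inequality fails.
square≤2^ : ∀ i → (4 + i) * (4 + i) ≤ 2 ^ (4 + i)
square≤2^ zero    = ≤-refl
square≤2^ (suc i) = begin
  (5 + i) * (5 + i)                       ≤⟨ m≤m+n _ (i * i + 6 * i + 7) ⟩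
  (5 + i) * (5 + i) + (i * i + 6 * i + 7) ≡⟨ arith i ⟩
  2 * ((4 + i) * (4 + i))                 ≤⟨ *-monoʳ-≤ 2 (square≤2^ i) ⟩
  2 ^ (5 + i)                             ∎
  where
  open ≤-Reasoning
  arith : ∀ i → (5 + i) * (5 + i) + (i * i + 6 * i + 7) ≡ 2 * ((4 + i) * (4 + i))
  arith = solve-∀

-- For `k = 2 * N + 6 + d` the left side is at most the square of `k`, and `slack` is the exact
-- difference.
linear<2^ : ∀ N k → 2 * N + 6 ≤ k → N * (k + 6) + 2 ≤ 2 ^ k
linear<2^ N k N≤k with d , refl ← m≤n⇒∃[o]m+o≡n N≤k = begin
  N * (2 * N + 6 + d + 6) + 2                                                   ≤⟨ m≤m+n _ slack ⟩
  N * (2 * N + 6 + d + 6) + 2 + slack                                           ≡⟨ expand N d ⟩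
  (4 + (2 * N + 2 + d)) * (4 + (2 * N + 2 + d))                                 ≤⟨ square≤2^ (2 * N + 2 + d) ⟩
  2 ^ (4 + (2 * N + 2 + d))                                                     ≡⟨ cong (2 ^_) (shift N d) ⟩
  2 ^ (2 * N + 6 + d)                                                           ∎
  where
  open ≤-Reasoning
  slack = 2 * N * N + 12 * N + 3 * N * d + 12 * d + d * d + 34
  expand : ∀ N d → N * (2 * N + 6 + d + 6) + 2 + (2 * N * N + 12 * N + 3 * N * d + 12 * d + d * d + 34)
    ≡ (4 + (2 * N + 2 + d)) * (4 + (2 * N + 2 + d))
  expand = solve-∀
  shift : ∀ N d → 4 + (2 * N + 2 + d) ≡ 2 * N + 6 + d
  shift = solve-∀

-- The bound is linear in `k` and independent of `n`, so it becomes negligible against `z` once `n`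
-- is exponential in `k`.
size-gap : ∀ k n z → n ≤ z → z ≤ k + 5 + n → ∣ k + 4 + 2 * n - 2 * z ∣ ≤ k + 6
size-gap k n z n≤z z≤ = ∣-∣≤
  (begin
    k + 4 + 2 * n       ≤⟨ +-mono-≤ (+-monoʳ-≤ k (m≤m+n 4 2)) (*-monoʳ-≤ 2 n≤z) ⟩
    k + 6 + 2 * z       ≡⟨ +-comm (k + 6) (2 * z) ⟩
    2 * z + (k + 6)     ∎)
  (begin
    2 * z                     ≤⟨ *-monoʳ-≤ 2 z≤ ⟩
    2 * (k + 5 + n)           ≡⟨ arith k n ⟩
    k + 4 + 2 * n + (k + 6)   ∎)
  where
  open ≤-Reasoning
  arith : ∀ k n → 2 * (k + 5 + n) ≡ k + 4 + 2 * n + (k + 6)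
  arith = solve-∀

1+pred-2^ : ∀ k → suc (pred (2 ^ k)) ≡ 2 ^ k
1+pred-2^ k = suc-pred (2 ^ k) ⦃ >-nonZero (m^n>0 2 k) ⦄

module W k = Word k (pred (2 ^ k)) (≤-reflexive (1+pred-2^ k))

theorem2 : ∃ λ (w : ℕ → Str) → ∃ λ (ze : ℕ → ℕ) → ∃ λ (zend : ℕ → ℕ) →
    (∀ k → ZE (w k) (ze k)) × (∀ k → ZEnd (w k) (zend k)) × RatioTendsTo2 ze zend
theorem2 = W.word , (λ k → k + 4 + 2 * pred (2 ^ k)) , zend ,
  W.greedySize , (λ k → proj₁ (proj₂ (W.optimalSize k))) , λ N _ → 2 * N + 6 , λ k N≤k →
    let _ , n≤z , z≤ = proj₂ (W.optimalSize k) in begin-strict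
    N * ∣ k + 4 + 2 * pred (2 ^ k) - 2 * zend k ∣ ≤⟨ *-monoʳ-≤ N (size-gap k (pred (2 ^ k)) (zend k) n≤z z≤) ⟩
    -- Of the summand 2 in `linear<2^`, one unit pays for passing from `2 ^ k` to its predecessor
    -- and the other for strictness.
    N * (k + 6)                                   <⟨ s≤s⁻¹ (subst₂ _≤_ (+-comm _ 2) (sym (1+pred-2^ k)) (linear<2^ N k N≤k)) ⟩
    pred (2 ^ k)                                  ≤⟨ n≤z ⟩
    zend k                                        ∎
  where
  open ≤-Reasoning
  zend : ℕ → ℕ
  zend k = proj₁ (W.optimalSize k)
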